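{- There is a nondeterministic oblivious read-once branching program of size $O(n^4)$ that computes the median on $n$ integers from $[2n]$.
   Context: $[N]=\{1,\dots,N\}$. For $n$ input integers (not necessarily distinct), the median is the middle element in sorted order (the $n/2$-th largest when $n$ is even). A (deterministic) branching program on $n$ inputs from a finite set $D$ (here $D=[2n]$) is a connected directed acyclic multigraph with a source node and possibly many sink nodes; each non-sink node is labeled by an input index in $[n]$, each edge by an element of $D$ (the value of the input indexed at its originating node), with exactly one out-edge of each non-sink node for each element of $D$; each sink is labeled by an output value. A nondeterministic branching program for a (non-Boolean) function is defined in the same way except that multiple out-edges of a node may have the same label and out-edges for some labels may not be present; every input must have at least one consistent path from the source that leads to a sink, and all paths followed by a given input that lead to a sink must lead to the same one, whose label is the output value. The size is the number of nodes. The program is oblivious if on every path from the source to a sink the sequence of input indices is precisely the same, and read-once if no input index appears more than once on any path from the source to a sink. -}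

module Defs where

open import Data.Fin using (Fin; fromℕ<)
open import Data.Fin.Properties using (≤-decTotalOrder)
open import Data.List using (List; []; _∷_; length; lookup; map; tabulate)
open import Data.List.Membership.Propositional using (_∈_)
open import Data.List.Relation.Binary.Permutation.Propositional.Properties using (↭-length)
open import Data.List.Properties using (length-tabulate)
open import Data.List.Relation.Unary.All using (All)
open import Data.List.Relation.Unary.Unique.Propositional using (Unique)
open import Data.List.Sort using (sort; sort-↭)
open import Data.Nat using (ℕ; suc; _<_; ⌊_/2⌋; NonZero)
open import Data.Nat.Properties using (⌊n/2⌋<n)
open import Data.Product using (∃; _×_; _,_; proj₁; proj₂)
open import Data.Vec.Functional using (Vector)
open import Function using (_⇔_)
open import Relation.Binary.Construct.Closure.Equivalence using (EqClosure)
open import Relation.Binary.Construct.Closure.Transitive using (TransClosure)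
open import Relation.Binary.PropositionalEquality using (_≡_; sym; trans; subst)
open import Relation.Nullary using (¬_)

data Label (n : ℕ) (R : Set) : Set where
  query  : Fin n → Label n R
  output : R → Label n R

-- Edges form a list, so parallel edges, also with equal labels, are allowed.
record LabelledGraph (n : ℕ) (D R : Set) : Set where
  field
    size   : ℕ
    source : Fin size
    label  : Fin size → Label n R
    edges  : List (Fin size × D × Fin size)

  Node : Set
  Node = Fin size

  _⟶_ : Node → Node → Set
  u ⟶ v = ∃ λ d → (u , d , v) ∈ edges

  IsSink : Node → Set
  IsSink v = ∃ λ r → label v ≡ output r

  -- A path is indexed by its trace: the queried index and the edge label
  -- of each of its steps.
  data Path : Node → List (Fin n × D) → Node → Set where
    []   : ∀ {u} → Path u [] u
    step : ∀ {u v w i d tr} → label u ≡ query i → (u , d , v) ∈ edges →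
           Path v tr w → Path u ((i , d) ∷ tr) w

  Consistent : Vector D n → List (Fin n × D) → Set
  Consistent x = All (λ (i , d) → x i ≡ d)

  Reaches : Vector D n → Node → Set
  Reaches x w = ∃ λ tr → Path source tr w × Consistent x tr

record NondeterministicBP (n : ℕ) (D R : Set) : Set where
  field
    graph : LabelledGraph n D R

  open LabelledGraph graph public

  field
    connected : ∀ u v → EqClosure _⟶_ u v
    acyclic   : ∀ v → ¬ TransClosure _⟶_ v v
    source⇔   : ∀ v → v ≡ source ⇔ (∀ u → ¬ (u ⟶ v))
    sink⇔     : ∀ u → IsSink u ⇔ (∀ v → ¬ (u ⟶ v))
    total     : ∀ x → ∃ λ w → IsSink w × Reaches x w
    unique    : ∀ x {w w′} → IsSink w → IsSink w′ →
                Reaches x w → Reaches x w′ → w ≡ w′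

  outputOn : Vector D n → R
  outputOn x = proj₁ (proj₁ (proj₂ (total x)))

  Computes : (Vector D n → R) → Set
  Computes f = ∀ x → outputOn x ≡ f x

  Oblivious : Set
  Oblivious = ∀ {tr tr′ w w′} → IsSink w → IsSink w′ →
              Path source tr w → Path source tr′ w′ →
              map proj₁ tr ≡ map proj₁ tr′

  ReadOnce : Set
  ReadOnce = ∀ {tr w} → IsSink w → Path source tr w → Unique (map proj₁ tr)

-- Fin N represents {1, …, N}, with j standing for suc (toℕ j).
-- The median is the ⌈n/2⌉-th largest input (n/2-th largest for even n, middle
-- for odd n). In increasing order its 0-based position is n ∸ ⌈n/2⌉ = ⌊n/2⌋.
sorted : ∀ {n N} → Vector (Fin N) n → List (Fin N)
sorted {N = N} x = sort (≤-decTotalOrder N) (tabulate x)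

length-sorted : ∀ {n N} (x : Vector (Fin N) n) → length (sorted x) ≡ n
length-sorted {N = N} x =
  trans (↭-length (sort-↭ (≤-decTotalOrder N) (tabulate x))) (length-tabulate x)

middle< : ∀ n → .{{_ : NonZero n}} → ⌊ n /2⌋ < n
middle< (suc n) = ⌊n/2⌋<n n

median : ∀ {n N} → .{{_ : NonZero n}} → Vector (Fin N) n → Fin N
median {n} x =
  lookup (sorted x) (fromℕ< (subst (⌊ n /2⌋ <_) (sym (length-sorted x)) (middle< n)))

{-# OPTIONS --safe #-}
module Submission where

-- Let k = ⌊n/2⌋ and l = n − 1 − k. A value m is the median iff the inputs can be
-- tagged so that k of them are low (≤ m), one is mid (= m) and l are high (≥ m):
-- the existence of such a tagging is invariant under permuting the inputs and
-- forces entry k (counted from 0) of the sorted list to be m. The program guesses m at the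
-- source, guesses a tag for each input, and remembers m and the number of inputs
-- still to be given each tag. These four numbers determine how many inputs have
-- been read, so there are only O(n³) nodes. Since an input equal to m can be given
-- any tag, no node is a dead end, and every node but the source has a predecessor.

open import Defs
open import Data.Fin as Fin using (Fin; toℕ; fromℕ<)
open import Data.Fin.Properties as Fin using (toℕ-injective; toℕ-fromℕ<)
open import Data.List
  using (List; []; _∷_; length; lookup; map; tabulate; reverse; filter; cartesianProduct;
         allFin; upTo; applyUpTo; downFrom)
open import Data.List.Membership.Propositional using (_∈_)
open import Data.List.Membership.Propositional.Properties
  using (∈-lookup; ∈-filter⁺; ∈-filter⁻; ∈-cartesianProduct⁺; ∈-cartesianProduct⁻;
         ∈-allFin; ∈-upTo⁺; ∈-upTo⁻)
open import Data.List.Properties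
  using (length-filter; length-upTo; length-tabulate; length-++; length-map;
         reverse-upTo; reverse-map; map-injective; ∷-injective; map-tabulate)
open import Data.List.Relation.Binary.Permutation.Propositional
  using (_↭_; refl; prep; swap; ↭-sym) renaming (trans to ↭-step)
open import Data.List.Relation.Binary.Permutation.Propositional.Properties using (↭-reverse; map⁺)
open import Data.List.Relation.Unary.All as All using (All; []; _∷_)
open import Data.List.Relation.Unary.AllPairs using (AllPairs; []; _∷_)
open import Data.List.Relation.Unary.Any using (Any; here; there; index)
open import Data.List.Relation.Unary.Any.Properties using (lookup-index)
open import Data.List.Relation.Unary.Sorted.TotalOrder.Properties using (Sorted⇒AllPairs)
open import Data.List.Relation.Unary.Unique.Propositional using (Unique)
import Data.List.Relation.Unary.Unique.Propositional.Properties as Unique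
open import Data.List.Sort using (sort-↭; sort-↗)
open import Data.Nat
open import Data.Nat.Properties as ℕ hiding (_≟_)
open import Data.Nat.Tactic.RingSolver using (solve-∀)
open import Data.Product using (Σ; ∃; ∃₂; _×_; _,_; proj₁; proj₂)
open import Data.Product.Properties using (≡-dec)
open import Data.Sum using (inj₁; inj₂)
open import Data.Vec.Functional using (Vector)
open import Function using (_∘_; id; mk⇔)
open import Relation.Binary.Bundles using (DecTotalOrder)
open import Relation.Binary.Construct.Closure.Equivalence as EqC using (EqClosure)
open import Relation.Binary.Construct.Closure.ReflexiveTransitive using (ε; _◅_; _◅◅_)
open import Relation.Binary.Construct.Closure.Symmetric using (fwd)
open import Relation.Binary.Construct.Closure.Transitive using (TransClosure; [_]; _∷_)
open import Relation.Binary.PropositionalEquality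
  using (_≡_; _≢_; refl; sym; trans; cong; cong₂; subst; module ≡-Reasoning)
open import Relation.Nullary using (¬_; Dec; yes; no; contradiction)
open import Relation.Nullary.Decidable using (_×-dec_; _⊎-dec_; _→-dec_; ¬?; map′)

-- Lists: injective lookup and enumeration of indices.

lookup-injective : ∀ {A : Set} {xs : List A} → Unique xs →
                   ∀ {i j} → lookup xs i ≡ lookup xs j → i ≡ j
lookup-injective (x∉ ∷ u) {Fin.zero}  {Fin.zero}  eq = refl
lookup-injective (x∉ ∷ u) {Fin.zero}  {Fin.suc j} eq = contradiction eq (All.lookup x∉ (∈-lookup j))
lookup-injective (x∉ ∷ u) {Fin.suc i} {Fin.zero}  eq = contradiction (sym eq) (All.lookup x∉ (∈-lookup i))
lookup-injective (x∉ ∷ u) {Fin.suc i} {Fin.suc j} eq = cong Fin.suc (lookup-injective u eq)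

map-toℕ-allFin : ∀ n → map toℕ (allFin n) ≡ upTo n
map-toℕ-allFin n = trans (map-tabulate id toℕ) (go n id)
  where
  go : ∀ n (f : ℕ → ℕ) → tabulate {n = n} (f ∘ toℕ) ≡ applyUpTo f n
  go zero    f = refl
  go (suc n) f = cong (f 0 ∷_) (go n (f ∘ suc))

-- Branching programs from levelled graphs.

module Levelled
  {n N : ℕ} {A R : Set}
  (height : A → ℕ) (out : A → R)
  (E : A → Fin N → A → Set) (E? : ∀ u d v → Dec (E u d v))
  (vs : List A) (root : A)
  where

  -- Paths over raw vertices instead of list positions. Membership in `vs` is recorded at each step
  -- so that a run can be turned back into a path of the graph.
  data Run : A → List (Fin N) → A → Set where
    []   : ∀ {u} → Run u [] u
    step : ∀ {u d v ds w} → E u d v → v ∈ vs → Run v ds w → Run u (d ∷ ds) w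

  -- A vertex of height suc h queries index h, so the inputs are read backwards.
  word : Vector (Fin N) n → List (Fin N)
  word x = map x (reverse (allFin n))

  -- The height is a separate argument so that the lemmas below can match on it. Sinks are exactly
  -- the vertices of height 0.
  labelOf : R → (h : ℕ) → h ≤ n → Label n R
  labelOf r zero    _   = output r
  labelOf r (suc h) h<n = query (fromℕ< h<n)

  labelOf-query⁻ : ∀ {r i} h (p : h ≤ n) → labelOf r h p ≡ query i → h ≡ suc (toℕ i)
  labelOf-query⁻ (suc h) p refl = cong suc (sym (toℕ-fromℕ< p))

  labelOf-query⁺ : ∀ {r i} h (p : h ≤ n) → h ≡ suc (toℕ i) → labelOf r h p ≡ query i
  labelOf-query⁺ (suc h) p eq =
    cong query (toℕ-injective (trans (toℕ-fromℕ< p) (ℕ.suc-injective eq)))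

  labelOf-output⁻ : ∀ {r r′} h (p : h ≤ n) → labelOf r h p ≡ output r′ → h ≡ 0
  labelOf-output⁻ zero p eq = refl

  labelOf-output⁺ : ∀ {r} h (p : h ≤ n) → h ≡ 0 → labelOf r h p ≡ output r
  labelOf-output⁺ zero p eq = refl

  module Program
    (vs-unique   : Unique vs)
    (height≤n    : ∀ {v} → v ∈ vs → height v ≤ n)
    (descends    : ∀ {u d v} → E u d v → height u ≡ suc (height v))
    (root∈       : root ∈ vs)
    (height-root : height root ≡ n)
    (pred        : ∀ {v} → v ∈ vs → v ≢ root → ∃₂ λ u d → u ∈ vs × E u d v)
    (succ        : ∀ {u} → u ∈ vs → height u ≢ 0 → ∃₂ λ d v → v ∈ vs × E u d v)
    (target      : Vector (Fin N) n → A)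
    (target∈     : ∀ x → target x ∈ vs)
    (target-height : ∀ x → height (target x) ≡ 0)
    (target-run  : ∀ x → Run root (word x) (target x))
    (run-target  : ∀ x {w} → height w ≡ 0 → Run root (word x) w → w ≡ target x)
    where

    at : Fin (length vs) → A
    at = lookup vs

    node : ∀ {v} → v ∈ vs → Fin (length vs)
    node = index

    at-node : ∀ {v} (v∈ : v ∈ vs) → at (node v∈) ≡ v
    at-node v∈ = sym (lookup-index v∈)

    bound : ∀ u → height (at u) ≤ n
    bound u = height≤n (∈-lookup u)

    Edge : Fin (length vs) × Fin N × Fin (length vs) → Set
    Edge (u , d , v) = E (at u) d (at v)

    Edge? : ∀ e → Dec (Edge e)
    Edge? (u , d , v) = E? (at u) d (at v)

    graph : LabelledGraph n (Fin N) R
    graph = record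
      { size   = length vs
      ; source = node root∈
      ; label  = λ u → labelOf (out (at u)) (height (at u)) (bound u)
      ; edges  = filter Edge? (cartesianProduct (allFin _) (cartesianProduct (allFin _) (allFin _)))
      }

    open LabelledGraph graph

    edge⁺ : ∀ {u d v} → E (at u) d (at v) → (u , d , v) ∈ edges
    edge⁺ e = ∈-filter⁺ Edge?
      (∈-cartesianProduct⁺ (∈-allFin _) (∈-cartesianProduct⁺ (∈-allFin _) (∈-allFin _))) e

    edge⁻ : ∀ {u d v} → (u , d , v) ∈ edges → E (at u) d (at v)
    edge⁻ e∈ = proj₂ (∈-filter⁻ Edge?
      {xs = cartesianProduct (allFin _) (cartesianProduct (allFin _) (allFin _))} e∈)

    ⟶-height : ∀ {u v} → u ⟶ v → height (at u) ≡ suc (height (at v))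
    ⟶-height (d , e∈) = descends (edge⁻ e∈)

    sink⇒height≡0 : ∀ {w} → IsSink w → height (at w) ≡ 0
    sink⇒height≡0 {w} (r , eq) = labelOf-output⁻ (height (at w)) (bound w) eq

    height≡0⇒sink : ∀ {w} → height (at w) ≡ 0 → IsSink w
    height≡0⇒sink {w} eq = _ , labelOf-output⁺ (height (at w)) (bound w) eq

    at-source : at source ≡ root
    at-source = at-node root∈

    predecessor : ∀ v → v ≢ source → ∃ λ u → u ⟶ v
    predecessor v v≢ with pred (∈-lookup v)
                            (λ eq → v≢ (lookup-injective vs-unique (trans eq (sym at-source))))
    ... | u , d , u∈ , e = node u∈ , d , edge⁺ (subst (λ z → E z d (at v)) (sym (at-node u∈)) e)

    successor : ∀ u → height (at u) ≢ 0 → ∃ λ v → u ⟶ v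
    successor u h≢ with succ (∈-lookup u) h≢
    ... | d , v , v∈ , e = node v∈ , d , edge⁺ (subst (E (at u) d) (sym (at-node v∈)) e)

    source-initial : ∀ u → ¬ (u ⟶ source)
    source-initial u e = 1+n≰n (subst (_≤ n)
      (trans (⟶-height e) (cong suc (trans (cong height at-source) height-root))) (bound u))

    -- Going to a predecessor raises the height by one and no height exceeds `n`, so walking
    -- backwards must stop, and it can stop only at the source. The number `g` bounds the steps
    -- left.
    from-source : ∀ g v → n ≤ g + height (at v) → EqClosure _⟶_ source v
    from-source g v gap with v Fin.≟ source
    ... | yes refl = ε
    ... | no v≢ with predecessor v v≢
    -- Here `v` has height at least `n`, so a predecessor would violate `bound`.
    from-source zero v gap | no _ | u , e =
      contradiction (subst (_≤ n) (⟶-height e) (bound u)) (<⇒≱ (s≤s gap))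
    from-source (suc g) v gap | no _ | u , e =
      from-source g u (subst (n ≤_) (trans (sym (+-suc g _)) (cong (g +_) (sym (⟶-height e)))) gap)
        ◅◅ (fwd e ◅ ε)

    ⟶⁺-height : ∀ {u v} → TransClosure _⟶_ u v → height (at v) < height (at u)
    ⟶⁺-height [ e ]    = ≤-reflexive (sym (⟶-height e))
    ⟶⁺-height (e ∷ es) = ℕ.<-trans (⟶⁺-height es) (≤-reflexive (sym (⟶-height e)))

    -- A vertex of height `suc h` queries index `h`, and each edge lowers the height by one. The
    -- start vertex thus fixes the whole query sequence, which gives both obliviousness and
    -- read-onceness.
    path-order : ∀ {u tr w} → IsSink w → Path u tr w →
                 map toℕ (map proj₁ tr) ≡ downFrom (height (at u))
    path-order sink [] rewrite sink⇒height≡0 sink = refl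
    path-order {u} sink (step {i = i} eq e∈ π) = begin
      toℕ i ∷ _                 ≡⟨ cong (toℕ i ∷_) (path-order sink π) ⟩
      toℕ i ∷ downFrom _        ≡⟨ cong (λ h → toℕ i ∷ downFrom h) height-v ⟩
      downFrom (suc (toℕ i))    ≡⟨ cong downFrom height-u ⟨
      downFrom (height (at u))  ∎
      where
      open ≡-Reasoning
      height-u = labelOf-query⁻ (height (at u)) (bound u) eq
      height-v = ℕ.suc-injective (trans (sym (⟶-height (_ , e∈))) height-u)

    source-order : ∀ {tr w} → IsSink w → Path source tr w → map proj₁ tr ≡ reverse (allFin n)
    source-order {tr} sink π = map-injective toℕ-injective (begin
      map toℕ (map proj₁ tr)           ≡⟨ path-order sink π ⟩
      downFrom (height (at source))    ≡⟨ cong downFrom (trans (cong height at-source) height-root) ⟩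
      downFrom n                       ≡⟨ reverse-upTo n ⟨
      reverse (upTo n)                 ≡⟨ cong reverse (map-toℕ-allFin n) ⟨
      reverse (map toℕ (allFin n))     ≡⟨ reverse-map toℕ (allFin n) ⟨
      map toℕ (reverse (allFin n))     ∎)
      where open ≡-Reasoning

    path⇒run : ∀ {u tr w} → Path u tr w → Run (at u) (map proj₂ tr) (at w)
    path⇒run []                = []
    path⇒run (step _ e∈ π) = step (edge⁻ e∈) (∈-lookup _) (path⇒run π)

    consistent-word : ∀ x {tr} → Consistent x tr → map proj₂ tr ≡ map x (map proj₁ tr)
    consistent-word x []       = refl
    consistent-word x (eq ∷ c) = cong₂ _∷_ (sym eq) (consistent-word x c)

    -- Since the query order is fixed, the edge labels of a consistent path spell `word x`, and
    -- `run-target` applies.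
    reaches⇒target : ∀ x {w} → IsSink w → Reaches x w → at w ≡ target x
    reaches⇒target x {w} sink (tr , π , c) = run-target x (sink⇒height≡0 sink)
      (subst (λ u → Run u (word x) (at w)) at-source
        (subst (λ ds → Run (at source) ds (at w))
          (trans (consistent-word x c) (cong (map x) (source-order sink π))) (path⇒run π)))

    -- The hypothesis `order` makes each vertex query the next index of `is`. Endpoints are given up
    -- to equality because `at (node v∈)` is only propositionally the vertex.
    run⇒path : ∀ x is {a w} → Run a (map x is) w → ∀ {u z} → at u ≡ a → at z ≡ w →
               map toℕ is ≡ downFrom (height a) → ∃ λ tr → Path u tr z × Consistent x tr
    run⇒path x [] [] {u} {z} eq eq′ _ with lookup-injective vs-unique {u} {z} (trans eq (sym eq′))
    ... | refl = [] , [] , []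
    run⇒path x (i ∷ is) (step e v∈ ρ) {u} refl eq′ order
      with ∷-injective (trans order (cong downFrom (descends e)))
    ... | i≡h , order′ with run⇒path x is ρ (at-node v∈) eq′ order′
    ... | tr , π , c = _ ,
      step (labelOf-query⁺ (height (at u)) (bound u) (trans (descends e) (cong suc (sym i≡h))))
           (edge⁺ (subst (E (at u) (x i)) (sym (at-node v∈)) e)) π ,
      refl ∷ c

    word-order : map toℕ (reverse (allFin n)) ≡ downFrom (height root)
    word-order = begin
      map toℕ (reverse (allFin n))  ≡⟨ reverse-map toℕ (allFin n) ⟩
      reverse (map toℕ (allFin n))  ≡⟨ cong reverse (map-toℕ-allFin n) ⟩
      reverse (upTo n)              ≡⟨ reverse-upTo n ⟩
      downFrom n                    ≡⟨ cong downFrom height-root ⟨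
      downFrom (height root)        ∎
      where open ≡-Reasoning

    target-label : ∀ x → label (node (target∈ x)) ≡ output (out (target x))
    target-label x = trans
      (labelOf-output⁺ _ (bound w) (trans (cong height (at-node (target∈ x))) (target-height x)))
      (cong (output ∘ out) (at-node (target∈ x)))
      where w = node (target∈ x)

    program : NondeterministicBP n (Fin N) R
    program = record
      { graph     = graph
      ; connected = λ u v → EqC.symmetric _⟶_ (from-source n u (m≤m+n n _))
                              ◅◅ from-source n v (m≤m+n n _)
      ; acyclic   = λ v v⟶⁺v → <-irrefl refl (⟶⁺-height v⟶⁺v)
      ; source⇔   = λ v → mk⇔ (λ where refl → source-initial) (initial⇒source v)
      ; sink⇔     = λ u → mk⇔ (sink⇒terminal u) (terminal⇒sink u)
      ; total     = λ x → node (target∈ x) , (out (target x) , target-label x) ,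
                      run⇒path x _ (target-run x) at-source (at-node (target∈ x)) word-order
      ; unique    = λ x sink sink′ r r′ → lookup-injective vs-unique
                      (trans (reaches⇒target x sink r) (sym (reaches⇒target x sink′ r′)))
      }
      where
      initial⇒source : ∀ v → (∀ u → ¬ (u ⟶ v)) → v ≡ source
      initial⇒source v none with v Fin.≟ source
      ... | yes eq = eq
      ... | no v≢ with predecessor v v≢
      ...   | u , e = contradiction e (none u)

      sink⇒terminal : ∀ u → IsSink u → ∀ v → ¬ (u ⟶ v)
      sink⇒terminal u sink v e with trans (sym (sink⇒height≡0 sink)) (⟶-height e)
      ... | ()

      terminal⇒sink : ∀ u → (∀ v → ¬ (u ⟶ v)) → IsSink u
      terminal⇒sink u none with height (at u) ≟ 0
      ... | yes h≡0 = height≡0⇒sink h≡0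
      ... | no  h≢0 with successor u h≢0
      ...   | v , e = contradiction e (none v)

    oblivious : NondeterministicBP.Oblivious program
    oblivious sink sink′ π π′ = trans (source-order sink π) (sym (source-order sink′ π′))

    readOnce : NondeterministicBP.ReadOnce program
    readOnce sink π = Unique.map⁻ (subst Unique (sym (path-order sink π)) (Unique.downFrom⁺ _))

    computes : NondeterministicBP.Computes program (out ∘ target)
    -- `outputOn` projects the sink label stored in `total`, which is `out (target x)` by
    -- construction.
    computes x = refl

-- Tags and counts of remaining inputs.

data Tag : Set where
  low mid high : Tag

anyTag? : ∀ {P : Tag → Set} → (∀ t → Dec (P t)) → Dec (∃ P)
anyTag? {P} P? = map′
  (λ { (inj₁ p) → low , p ; (inj₂ (inj₁ p)) → mid , p ; (inj₂ (inj₂ p)) → high , p })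
  (λ { (low , p) → inj₁ p ; (mid , p) → inj₂ (inj₁ p) ; (high , p) → inj₂ (inj₂ p) })
  (P? low ⊎-dec (P? mid ⊎-dec P? high))

-- The numbers of low, mid and high inputs still to be read.
State : Set
State = ℕ × ℕ × ℕ

_≟ₛ_ : (s s′ : State) → Dec (s ≡ s′)
_≟ₛ_ = ≡-dec _≟_ (≡-dec _≟_ _≟_)

empty : State
empty = 0 , 0 , 0

add : Tag → State → State
add low  (p , r , q) = suc p , r , q
add mid  (p , r , q) = p , suc r , q
add high (p , r , q) = p , r , suc q

-- With `r` first, the value at `full` reduces to `suc k + (n ∸ suc k)` for `k = ⌊ n /2⌋`.
remaining : State → ℕ
remaining (p , r , q) = r + (p + q)

add-comm : ∀ t t′ s → add t (add t′ s) ≡ add t′ (add t s)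
add-comm low  low  s = refl
add-comm low  mid  s = refl
add-comm low  high s = refl
add-comm mid  low  s = refl
add-comm mid  mid  s = refl
add-comm mid  high s = refl
add-comm high low  s = refl
add-comm high mid  s = refl
add-comm high high s = refl

remaining-add : ∀ t s → remaining (add t s) ≡ suc (remaining s)
remaining-add low  (p , r , q) = +-suc r (p + q)
remaining-add mid  (p , r , q) = refl
remaining-add high (p , r , q) = trans (cong (r +_) (+-suc p q)) (+-suc r (p + q))

remaining≡0⇒empty : ∀ s → remaining s ≡ 0 → s ≡ empty
remaining≡0⇒empty (zero , zero , zero) eq = refl

-- Supplies a tag for the next input, so that a vertex of positive height is never a dead end.
remove : ∀ s → remaining s ≢ 0 → ∃₂ λ t s′ → s ≡ add t s′
remove (suc p , r , q)        _  = low , (p , r , q) , refl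
remove (zero , suc r , q)     _  = mid , (0 , r , q) , refl
remove (zero , zero , suc q)  _  = high , (0 , 0 , q) , refl
remove (zero , zero , zero)   h≢ = contradiction refl h≢

-- Componentwise order on states and the number of states.

_⊑_ : State → State → Set
(p , r , q) ⊑ (p′ , r′ , q′) = p ≤ p′ × r ≤ r′ × q ≤ q′

add⊑⇒⊑ : ∀ t {s f} → add t s ⊑ f → s ⊑ f
add⊑⇒⊑ low  (a , b , c) = <⇒≤ a , b , c
add⊑⇒⊑ mid  (a , b , c) = a , <⇒≤ b , c
add⊑⇒⊑ high (a , b , c) = a , b , <⇒≤ c

add⊑⇒≢ : ∀ t {s f} → add t s ⊑ f → s ≢ f
add⊑⇒≢ low  (a , _ , _) refl = 1+n≰n a
add⊑⇒≢ mid  (_ , b , _) refl = 1+n≰n b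
add⊑⇒≢ high (_ , _ , c) refl = 1+n≰n c

-- Some component has slack and can be raised. This yields the predecessor of a state other than the
-- full one.
⊑⇒add⊑ : ∀ {s f} → s ⊑ f → s ≢ f → ∃ λ t → add t s ⊑ f
⊑⇒add⊑ (a , b , c) s≢f with m≤n⇒m<n∨m≡n a | m≤n⇒m<n∨m≡n b | m≤n⇒m<n∨m≡n c
... | inj₁ a< | _       | _       = low , a< , b , c
... | inj₂ _  | inj₁ b< | _       = mid , a , b< , c
... | inj₂ _  | inj₂ _  | inj₁ c< = high , a , b , c<
... | inj₂ refl | inj₂ refl | inj₂ refl = contradiction refl s≢f

remaining-mono : ∀ {s f} → s ⊑ f → remaining s ≤ remaining f
remaining-mono (a , b , c) = +-mono-≤ b (+-mono-≤ a c)

below : State → List State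
below (p , r , q) = cartesianProduct (upTo (suc p)) (cartesianProduct (upTo (suc r)) (upTo (suc q)))

below⁺ : ∀ {s f} → s ⊑ f → s ∈ below f
below⁺ (a , b , c) =
  ∈-cartesianProduct⁺ (∈-upTo⁺ (s≤s a)) (∈-cartesianProduct⁺ (∈-upTo⁺ (s≤s b)) (∈-upTo⁺ (s≤s c)))

below⁻ : ∀ {s} f → s ∈ below f → s ⊑ f
below⁻ (p , r , q) s∈ with ∈-cartesianProduct⁻ (upTo (suc p)) _ s∈
... | a , s∈′ with ∈-cartesianProduct⁻ (upTo (suc r)) (upTo (suc q)) s∈′
... | b , c = ≤-pred (∈-upTo⁻ a) , ≤-pred (∈-upTo⁻ b) , ≤-pred (∈-upTo⁻ c)

below-unique : ∀ f → Unique (below f)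
below-unique (p , r , q) = Unique.cartesianProduct⁺ (Unique.upTo⁺ (suc p))
  (Unique.cartesianProduct⁺ (Unique.upTo⁺ (suc r)) (Unique.upTo⁺ (suc q)))

length-cartesianProduct : ∀ {A B : Set} (xs : List A) (ys : List B) →
                          length (cartesianProduct xs ys) ≡ length xs * length ys
length-cartesianProduct []       ys = refl
length-cartesianProduct (x ∷ xs) ys = trans (length-++ (map (x ,_) ys))
  (cong₂ _+_ (length-map (x ,_) ys) (length-cartesianProduct xs ys))

length-below : ∀ p r q → length (below (p , r , q)) ≡ suc p * (suc r * suc q)
length-below p r q = trans
  (length-cartesianProduct (upTo (suc p)) (cartesianProduct (upTo (suc r)) (upTo (suc q))))
  (cong₂ _*_ (length-upTo (suc p)) (trans (length-cartesianProduct (upTo (suc r)) (upTo (suc q)))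
    (cong₂ _*_ (length-upTo (suc r)) (length-upTo (suc q)))))

n∸1+k<n : ∀ n k .{{_ : NonZero n}} → n ∸ suc k < n
n∸1+k<n (suc n) k = s≤s (m∸n≤m n k)

-- Taggings of lists and entries of sorted lists.

module _ {N : ℕ} where

  Fits : Tag → Fin N → Fin N → Set
  Fits low  d m = d Fin.≤ m
  Fits mid  d m = d ≡ m
  Fits high d m = m Fin.≤ d

  Fits? : ∀ t d m → Dec (Fits t d m)
  Fits? low  d m = d Fin.≤? m
  Fits? mid  d m = d Fin.≟ m
  Fits? high d m = m Fin.≤? d

  fits-refl : ∀ t m → Fits t m m
  fits-refl low  m = ≤-refl
  fits-refl mid  m = refl
  fits-refl high m = ≤-refl

  -- The bridge between runs and sorted lists: a run that ends in `empty` with guess `m` chooses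
  -- just such tags.
  data Split (m : Fin N) : State → List (Fin N) → Set where
    []   : Split m empty []
    cons : ∀ t {d s ds} → Fits t d m → Split m s ds → Split m (add t s) (d ∷ ds)

  -- Tags travel with their entries, and the counts do not depend on the order.
  split-↭ : ∀ {m s xs ys} → xs ↭ ys → Split m s xs → Split m s ys
  split-↭ refl σ = σ
  split-↭ (prep x xs↭ys) (cons t fits σ) = cons t fits (split-↭ xs↭ys σ)
  split-↭ (swap x y xs↭ys) (cons t fits (cons t′ {s = s} fits′ σ)) =
    subst (λ s → Split _ s _) (add-comm t′ t s) (cons t′ fits′ (cons t fits (split-↭ xs↭ys σ)))
  split-↭ (↭-step p q) σ = split-↭ q (split-↭ p σ)

  Ascending : List (Fin N) → Set
  Ascending = AllPairs Fin._≤_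

  split⇒some≤ : ∀ {m s ys} → Split m s ys → 0 < proj₁ (proj₂ s) + proj₁ s → Any (Fin._≤ m) ys
  split⇒some≤ (cons low  fits σ)    _   = here fits
  split⇒some≤ (cons mid  refl σ)    _   = here ≤-refl
  split⇒some≤ (cons high fits σ)    pos = there (split⇒some≤ σ pos)

  -- The sum counts the entries tagged low or mid. All of these are at most `m`, so in ascending
  -- order that many initial entries are at most `m`.
  lookup≤ : ∀ {m s ys} → Ascending ys → Split m s ys → ∀ i →
            toℕ i < proj₁ (proj₂ s) + proj₁ s → lookup ys i Fin.≤ m
  lookup≤ _ (cons low  fits σ) Fin.zero _ = fits
  lookup≤ _ (cons mid  refl σ) Fin.zero _ = ≤-refl
  -- The head is tagged high, but a low or mid entry still follows; it is at most `m` and, by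
  -- sortedness, at least the head.
  lookup≤ {m} (y≤ ∷ _) (cons high fits σ) Fin.zero lt with All.lookupAny y≤ (split⇒some≤ σ lt)
  ... | y≤z , z≤m = ≤-trans y≤z z≤m
  lookup≤ (_ ∷ asc) (cons low {s = s} fits σ) (Fin.suc i) lt =
    lookup≤ asc σ i (≤-pred (subst (suc (toℕ i) <_) (+-suc (proj₁ (proj₂ s)) (proj₁ s)) lt))
  lookup≤ (_ ∷ asc) (cons mid  fits σ) (Fin.suc i) lt = lookup≤ asc σ i (≤-pred lt)
  lookup≤ (_ ∷ asc) (cons high fits σ) (Fin.suc i) lt = lookup≤ asc σ i (<⇒≤ lt)

  -- A low head uses up one of the positions before the bound. At the first head tagged mid or high,
  -- that head is at least `m`, and sortedness settles all later entries.
  ≤lookup : ∀ {m s ys} → Ascending ys → Split m s ys → ∀ i →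
            proj₁ s ≤ toℕ i → m Fin.≤ lookup ys i
  ≤lookup _ (cons mid  refl σ) Fin.zero _ = ≤-refl
  ≤lookup _ (cons high fits σ) Fin.zero _ = fits
  ≤lookup (_ ∷ asc) (cons low  fits σ) (Fin.suc i) le = ≤lookup asc σ i (≤-pred le)
  ≤lookup (y≤ ∷ _)  (cons mid  refl σ) (Fin.suc i) _  = All.lookup y≤ (∈-lookup i)
  ≤lookup (y≤ ∷ _)  (cons high fits σ) (Fin.suc i) _  = ≤-trans fits (All.lookup y≤ (∈-lookup i))

  split-all-high : ∀ {m ys} → All (m Fin.≤_) ys → Split m (0 , 0 , length ys) ys
  split-all-high []         = []
  split-all-high (m≤y ∷ m≤) = cons high m≤y (split-all-high m≤)

  -- In an ascending list, entries before position `i` can be tagged low and those after it high.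
  split-at : ∀ {ys} → Ascending ys → ∀ i →
             Split (lookup ys i) (toℕ i , 1 , length ys ∸ suc (toℕ i)) ys
  split-at (y≤ ∷ _)   Fin.zero    = cons mid refl (split-all-high y≤)
  split-at (y≤ ∷ asc) (Fin.suc i) = cons low (All.lookup y≤ (∈-lookup i)) (split-at asc i)

  sorted-ascending : ∀ {n} (x : Vector (Fin N) n) → Ascending (sorted x)
  sorted-ascending x = Sorted⇒AllPairs totalOrder (sort-↗ (Fin.≤-decTotalOrder N) (tabulate x))
    where open DecTotalOrder (Fin.≤-decTotalOrder N) using (totalOrder)

-- The program that guesses the median.

module Median (n : ℕ) .{{_ : NonZero n}} {N : ℕ} (o : Fin N) where

  full : State
  full = ⌊ n /2⌋ , 1 , n ∸ suc ⌊ n /2⌋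

  remaining-full : remaining full ≡ n
  remaining-full = m+[n∸m]≡n (middle< n)

  Vertex : Set
  Vertex = Fin N × State

  height : Vertex → ℕ
  height (m , s) = remaining s

  -- The copies (m , full) of the source are merged into (o , full), whose first
  -- component is therefore not a guess and may change along an edge.
  E : Vertex → Fin N → Vertex → Set
  E (m , s) d (m′ , s′) = (s ≢ full → m ≡ m′) × ∃ λ t → Fits t d m′ × s ≡ add t s′

  E? : ∀ u d v → Dec (E u d v)
  E? (m , s) d (m′ , s′) =
    (¬? (s ≟ₛ full) →-dec m Fin.≟ m′) ×-dec anyTag? (λ t → Fits? t d m′ ×-dec (s ≟ₛ add t s′))

  -- Selects `(o , full)` among all copies of the full state, which makes the source unique.
  Canonical : Vertex → Set
  Canonical (m , s) = s ≡ full → m ≡ o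

  Canonical? : ∀ v → Dec (Canonical v)
  Canonical? (m , s) = (s ≟ₛ full) →-dec (m Fin.≟ o)

  vertices : List Vertex
  vertices = filter Canonical? (cartesianProduct (allFin N) (below full))

  root : Vertex
  root = o , full

  open Levelled {n} height proj₁ E E? vertices root

  vertices⁺ : ∀ {m s} → s ⊑ full → Canonical (m , s) → (m , s) ∈ vertices
  vertices⁺ s⊑ canonical = ∈-filter⁺ Canonical? (∈-cartesianProduct⁺ (∈-allFin _) (below⁺ s⊑)) canonical

  vertices⁻ : ∀ {m s} → (m , s) ∈ vertices → s ⊑ full × Canonical (m , s)
  vertices⁻ v∈ with ∈-filter⁻ Canonical? {xs = cartesianProduct (allFin N) (below full)} v∈
  ... | v∈′ , canonical = below⁻ full (proj₂ (∈-cartesianProduct⁻ (allFin N) _ v∈′)) , canonical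

  vertices-unique : Unique vertices
  vertices-unique = Unique.filter⁺ Canonical?
    (Unique.cartesianProduct⁺ (Unique.allFin⁺ N) (below-unique full))

  proper : ∀ {m} t {s} → add t s ⊑ full → (m , s) ∈ vertices
  proper t add⊑ = vertices⁺ (add⊑⇒⊑ t add⊑) (λ eq → contradiction eq (add⊑⇒≢ t add⊑))

  root∈ : root ∈ vertices
  root∈ = vertices⁺ (≤-refl , ≤-refl , ≤-refl) (λ _ → refl)

  height≤n : ∀ {v} → v ∈ vertices → height v ≤ n
  height≤n v∈ = subst (_ ≤_) remaining-full (remaining-mono (proj₁ (vertices⁻ v∈)))

  descends : ∀ {u d v} → E u d v → height u ≡ suc (height v)
  descends (_ , t , _ , refl) = remaining-add t _

  pred∈ : ∀ {v} → v ∈ vertices → v ≢ root → ∃₂ λ u d → u ∈ vertices × E u d v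
  pred∈ {m , s} v∈ v≢root with vertices⁻ v∈
  ... | s⊑ , canonical with ⊑⇒add⊑ s⊑ (λ { refl → v≢root (cong (_, full) (canonical refl)) })
  ... | t , add⊑ with add t s ≟ₛ full
  -- The root may change its guess, so it precedes `v` whatever `m` is. The label `m` works here and
  -- below because a value equal to the guess fits every tag.
  ...   | yes eq = root , m , root∈ , (λ full≢ → contradiction refl full≢) , t , fits-refl t m , sym eq
  ...   | no neq = (m , add t s) , m , vertices⁺ add⊑ (λ eq → contradiction eq neq) ,
                   (λ _ → refl) , t , fits-refl t m , refl

  succ∈ : ∀ {u} → u ∈ vertices → height u ≢ 0 → ∃₂ λ d v → v ∈ vertices × E u d v
  succ∈ {m , s} u∈ h≢0 with remove s h≢0
  ... | t , s′ , refl = m , (m , s′) , proper t (proj₁ (vertices⁻ u∈)) , (λ _ → refl) , t , fits-refl t m , refl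

  -- Only an edge leaving `full` may change the guess, and no later state is `full`. Hence every
  -- vertex after the first step carries the final value `m`, and all tags are checked against it.
  run⇒split : ∀ {m′ s m ds} → s ⊑ full → Run (m′ , s) ds (m , empty) →
              (s ≢ full → m′ ≡ m) × Split m s ds
  run⇒split s⊑ [] = (λ _ → refl) , []
  run⇒split s⊑ (step {v = m″ , s′} (same , t , fits , refl) v∈ ρ)
    with run⇒split (add⊑⇒⊑ t s⊑) ρ
  ... | same′ , σ with same′ (add⊑⇒≢ t s⊑)
  ...   | refl = same , cons t fits σ

  split⇒run : ∀ {m′ s m ds} → s ⊑ full → (s ≢ full → m′ ≡ m) → Split m s ds →
              Run (m′ , s) ds (m , empty)
  -- `empty` differs from `full` in the mid count, so `same` applies.
  split⇒run s⊑ same [] with same (λ ())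
  ... | refl = []
  split⇒run s⊑ same (cons t fits σ) =
    step (same , t , fits , refl) (proper t s⊑) (split⇒run (add⊑⇒⊑ t s⊑) (λ _ → refl) σ)

  -- Carries taggings between the reading order and the sorted order.
  word↭sorted : ∀ (x : Vector (Fin N) n) → word x ↭ sorted x
  word↭sorted x = ↭-step (map⁺ x (↭-reverse (allFin n)))
    (subst (_↭ sorted x) (sym (map-tabulate id x)) (↭-sym (sort-↭ (Fin.≤-decTotalOrder N) (tabulate x))))

  middle : (x : Vector (Fin N) n) → Fin (length (sorted x))
  middle x = fromℕ< (subst (⌊ n /2⌋ <_) (sym (length-sorted x)) (middle< n))

  toℕ-middle : ∀ x → toℕ (middle x) ≡ ⌊ n /2⌋
  toℕ-middle x = toℕ-fromℕ< _

  median-split : ∀ x → Split (median x) full (sorted x)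
  median-split x = subst (λ s → Split (median x) s (sorted x))
    (cong₂ (λ k l → k , 1 , l ∸ suc k) (toℕ-middle x) (length-sorted x))
    (split-at (sorted-ascending x) (middle x))

  -- With `k = ⌊ n /2⌋`, the `k` low tags force entry `k` to be at least `m`, and the `suc k` low or
  -- mid tags force it to be at most `m`.
  split⇒median : ∀ x {m} → Split m full (sorted x) → m ≡ median x
  split⇒median x σ = Fin.≤-antisym
    (≤lookup (sorted-ascending x) σ (middle x) (≤-reflexive (sym (toℕ-middle x))))
    (lookup≤ (sorted-ascending x) σ (middle x) (s≤s (≤-reflexive (toℕ-middle x))))

  target : Vector (Fin N) n → Vertex
  target x = median x , empty

  target-run : ∀ x → Run root (word x) (target x)
  target-run x = split⇒run (≤-refl , ≤-refl , ≤-refl) (λ full≢ → contradiction refl full≢)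
    (split-↭ (↭-sym (word↭sorted x)) (median-split x))

  run-target : ∀ x {w} → height w ≡ 0 → Run root (word x) w → w ≡ target x
  run-target x {m , s} h≡0 ρ with remaining≡0⇒empty s h≡0
  ... | refl = cong (_, empty) (split⇒median x
        (split-↭ (word↭sorted x) (proj₂ (run⇒split (≤-refl , ≤-refl , ≤-refl) ρ))))

  open Program vertices-unique height≤n descends root∈ remaining-full pred∈ succ∈
    target (λ _ → vertices⁺ (z≤n , z≤n , z≤n) (λ ())) (λ _ → refl) target-run run-target
    public using (program; oblivious; readOnce; computes)

  -- The size of the program.

  length-vertices : length vertices ≤ N * (n * (2 * n))
  length-vertices = begin
    length vertices                          ≤⟨ length-filter Canonical? candidates ⟩
    length candidates                        ≡⟨ length-cartesianProduct (allFin N) (below full) ⟩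
    length (allFin N) * length (below full)  ≡⟨ cong₂ _*_ (length-tabulate {n = N} id) (length-below k 1 l) ⟩
    -- The 2 stands for the mid counts 0 and 1; both `suc k` and `suc l` are at most `n`.
    N * (suc k * (2 * suc l))                ≤⟨ *-monoʳ-≤ N (*-mono-≤ (middle< n) (*-monoʳ-≤ 2 (n∸1+k<n n k))) ⟩
    N * (n * (2 * n))                        ∎
    where
    open ≤-Reasoning
    k = ⌊ n /2⌋
    l = n ∸ suc k
    candidates = cartesianProduct (allFin N) (below full)

lemma8 : ∃ λ (C : ℕ) → ∀ (n : ℕ) → .{{_ : NonZero n}} →
    Σ (NondeterministicBP n (Fin (2 * n)) (Fin (2 * n))) λ P →
    let open NondeterministicBP P in
    size ≤ C * n ^ 4 × Oblivious × ReadOnce × Computes median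
-- One factor 2 comes from the `2 * n` guesses, the other from the mid count.
lemma8 = 4 , construct
  where
  cubic : ∀ n → 2 * n * (n * (2 * n)) ≡ 4 * (n * (n * (n * 1)))
  cubic = solve-∀

  construct : ∀ n .{{_ : NonZero n}} → Σ (NondeterministicBP n (Fin (2 * n)) (Fin (2 * n))) λ P →
    let open NondeterministicBP P in
    size ≤ 4 * n ^ 4 × Oblivious × ReadOnce × Computes median
  -- Matching on `suc` makes `Fin (2 * n)` visibly inhabited, so `Fin.zero` can be the placeholder
  -- value at the source.
  construct n@(suc _) = program , size≤ , oblivious , readOnce , computes
    where
    open Median n {2 * n} Fin.zero
    open ≤-Reasoning
    size≤ : NondeterministicBP.size program ≤ 4 * n ^ 4
    size≤ = begin
      length vertices          ≤⟨ length-vertices ⟩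
      2 * n * (n * (2 * n))    ≡⟨ cubic n ⟩
      4 * n ^ 3                ≤⟨ *-monoʳ-≤ 4 (^-monoʳ-≤ n (n≤1+n 3)) ⟩
      4 * n ^ 4                ∎
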